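{- Every derivable sequent has exactly one focused derivation: if $\Gamma$ is a context and $A$ a formula such that $\Gamma \longrightarrow A$ is derivable using the rules $*L$, $*R$, $id$, and $cut$, then there is exactly one focused derivation of $\Gamma \longrightarrow A$.
   Context: Fix a set of atoms. Formulas are generated by: every atom $p$ is a formula, and if $A,B$ are formulas then $A*B$ is a (compound) formula. A context ($\Gamma,\Delta,\Theta$) is a possibly empty finite list of formulas; comma denotes concatenation. A sequent $\Gamma \longrightarrow A$ is a pair of a context $\Gamma$ and a formula $A$. The rules of the sequent calculus are: - $*L$: from $A,B,\Delta \longrightarrow C$ infer $A*B,\Delta \longrightarrow C$; - $*R$: from $\Gamma \longrightarrow A$ and $\Delta \longrightarrow B$ infer $\Gamma,\Delta \longrightarrow A*B$; - $id$: infer $A \longrightarrow A$ (no premises); - $cut$: from $\Theta \longrightarrow A$ and $\Gamma,A,\Delta \longrightarrow B$ infer $\Gamma,\Theta,\Delta \longrightarrow B$. A closed derivation is a finite tree of rule instances (internal nodes labelled by rule names, edges labelled by sequents) with no undischarged premises; a sequent is derivable if it is the conclusion of a closed derivation. A context is reducible if its leftmost formula is compound, and irreducible otherwise. A sequent $\Gamma \longrightarrow A$ is left-inverting if $\Gamma$ is reducible; right-focusing if $\Gamma$ is irreducible and $A$ is compound; atomic if $\Gamma$ is irreducible and $A$ is an atom. A closed derivation is focused if left-inverting sequents only appear in it as conclusions of $*L$, right-focusing sequents only as conclusions of $*R$, and atomic sequents only as conclusions of $id$. Equivalently, it is constructed using only $*L$, the restriction of $*R$ in which the context $\Gamma$ of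 the left premise $\Gamma \longrightarrow A$ is irreducible, and the restriction of $id$ to atoms (and no $cut$). -}

module Defs where

open import Data.List.Base using (List; []; _∷_; _++_; [_])
open import Data.Product.Base using (_×_)
open import Level using (Level)
open import Relation.Binary.PropositionalEquality.Core using (_≡_)
open import Relation.Nullary.Negation.Core using (¬_)

infixr 7 _*_
infix  3 _⟶_

data Formula {a : Level} (Atom : Set a) : Set a where
  atom : Atom → Formula Atom
  _*_  : Formula Atom → Formula Atom → Formula Atom

Context : {a : Level} → Set a → Set a
Context Atom = List (Formula Atom)

record Sequent {a : Level} (Atom : Set a) : Set a where
  constructor _⟶_
  field
    context : Context Atom
    formula : Formula Atom

-- Closed derivations of a sequent; a sequent is derivable when this type is
-- inhabited.
data Derivation {a : Level} {Atom : Set a} : Sequent Atom → Set a where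
  *L  : {A B C : Formula Atom} {Δ : Context Atom} →
        Derivation (A ∷ B ∷ Δ ⟶ C) →
        Derivation (A * B ∷ Δ ⟶ C)
  *R  : {Γ Δ : Context Atom} {A B : Formula Atom} →
        Derivation (Γ ⟶ A) →
        Derivation (Δ ⟶ B) →
        Derivation (Γ ++ Δ ⟶ A * B)
  id  : {A : Formula Atom} →
        Derivation ([ A ] ⟶ A)
  cut : {Γ Θ Δ : Context Atom} {A B : Formula Atom} →
        Derivation (Θ ⟶ A) →
        Derivation (Γ ++ [ A ] ++ Δ ⟶ B) →
        Derivation (Γ ++ Θ ++ Δ ⟶ B)

data IsCompound {a : Level} {Atom : Set a} : Formula Atom → Set a where
  compound : {A B : Formula Atom} → IsCompound (A * B)

data IsAtom {a : Level} {Atom : Set a} : Formula Atom → Set a where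
  isAtom : {p : Atom} → IsAtom (atom p)

data Reducible {a : Level} {Atom : Set a} : Context Atom → Set a where
  leftmost : {A : Formula Atom} {Γ : Context Atom} →
             IsCompound A → Reducible (A ∷ Γ)

-- In particular the empty context is irreducible.
Irreducible : {a : Level} {Atom : Set a} → Context Atom → Set a
Irreducible Γ = ¬ Reducible Γ

LeftInverting : {a : Level} {Atom : Set a} → Sequent Atom → Set a
LeftInverting (Γ ⟶ A) = Reducible Γ

RightFocusing : {a : Level} {Atom : Set a} → Sequent Atom → Set a
RightFocusing (Γ ⟶ A) = Irreducible Γ × IsCompound A

Atomic : {a : Level} {Atom : Set a} → Sequent Atom → Set a
Atomic (Γ ⟶ A) = Irreducible Γ × IsAtom A

data RuleName : Set where
  *L *R id cut : RuleName

-- The three cases are exhaustive, so no sequent may be concluded by cut.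
record MayConclude {a : Level} {Atom : Set a}
                   (r : RuleName) (s : Sequent Atom) : Set a where
  field
    leftInverting : LeftInverting s → r ≡ *L
    rightFocusing : RightFocusing s → r ≡ *R
    atomic        : Atomic s → r ≡ id

-- Derivations are closed, so every sequent occurring in one is the conclusion
-- of exactly one of its rule instances; it suffices to check each instance.
Focused : {a : Level} {Atom : Set a} {s : Sequent Atom} → Derivation s → Set a
Focused {s = s} (*L d)    = MayConclude *L s × Focused d
Focused {s = s} (*R d e)  = MayConclude *R s × Focused d × Focused e
Focused {s = s} id        = MayConclude id s
Focused {s = s} (cut d e) = MayConclude cut s × Focused d × Focused e

{-# OPTIONS --safe #-}
module Submission where

-- Focused derivations are exactly the trees of the inductive family `Normal`,
-- which has no cut, the axiom at atoms only, and a right rule whose left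
-- premise starts with an atom.
--
-- Existence: the unrestricted right rule (`right`), identity (`identity`) and
-- cut (`cutNormal`) are all admissible for normal derivations, so every
-- derivation normalises.  A cut moves up the right premise as long as its cut
-- formula is not leftmost, or is an atom, in which case it ends at an axiom.
-- Once a compound cut formula A * B is leftmost, the right premise must end in
-- the left rule; the cut then moves up the left premise, past left rules, until
-- a right rule is reached and the cut splits into one on B and one on A.
--
-- Uniqueness: the last rule is dictated by the sequent, and the only freedom
-- is how the right rule splits the context.  A derivable sequent has as many
-- atom occurrences in its context as in its formula (`weight-balance`), so the
-- left premise for A * B takes the prefix with as many atom occurrences as A.
-- There is at most one such prefix, since every formula contains an atom
-- (`++-split-unique`).

open import Defs
open import Data.Empty using (⊥-elim)
open import Data.List.Base using (List; []; _∷_; _++_; [_])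
open import Data.List.Properties using (++-assoc; ++-identityʳ; ∷-injective)
open import Data.Nat.Base using (ℕ; _+_)
open import Data.Nat.Properties
  using (+-assoc; +-cancelˡ-≡; m+n≡0⇒m≡0)
open import Data.Product using (∃!; ∃-syntax; _×_; _,_)
open import Data.Sum using (_⊎_; inj₁; inj₂)
open import Relation.Nullary using (¬_)
open import Relation.Binary.PropositionalEquality
  using (_≡_; refl; sym; trans; cong; cong₂; subst)

-- Focused derivations as a family of their own.  The left premise of `right₀`
-- has an irreducible context; since no sequent with an empty context is
-- derivable, that context starts with an atom.
data Normal {a} {Atom : Set a} : Sequent Atom → Set a where
  left   : ∀ {A B C Δ} → Normal (A ∷ B ∷ Δ ⟶ C) → Normal (A * B ∷ Δ ⟶ C)
  right₀ : ∀ {p Γ Δ A B} → Normal (atom p ∷ Γ ⟶ A) → Normal (Δ ⟶ B) →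
           Normal (atom p ∷ Γ ++ Δ ⟶ A * B)
  ax     : ∀ {p} → Normal ([ atom p ] ⟶ atom p)

module _ {a} {Atom : Set a} where

  private variable
    A B       : Formula Atom
    Γ Δ Θ Ξ   : Context Atom
    s         : Sequent Atom

  recontext : Γ ≡ Δ → Normal (Γ ⟶ A) → Normal (Δ ⟶ A)
  recontext {A = A} = subst (λ Γ → Normal (Γ ⟶ A))

  -- Admissible rules

  right : Normal (Γ ⟶ A) → Normal (Δ ⟶ B) → Normal (Γ ++ Δ ⟶ A * B)
  right (left d)       e = left (right d e)
  right (right₀ d₁ d₂) e = right₀ (right₀ d₁ d₂) e
  right ax             e = right₀ ax e

  identity : ∀ A → Normal ([ A ] ⟶ A)
  identity (atom p) = ax
  identity (A * B)  = left (right (identity A) (identity B))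

  -- A marked element of a concatenation lies in one of the two factors.
  ++-locate : ∀ {ℓ} {X : Set ℓ} (xs : List X) {ys} us {x vs} →
    xs ++ ys ≡ us ++ x ∷ vs →
    (∃[ ws ] xs ≡ us ++ x ∷ ws × vs ≡ ws ++ ys) ⊎
    (∃[ ws ] us ≡ xs ++ ws × ys ≡ ws ++ x ∷ vs)
  ++-locate []       us       eq   = inj₂ (us , refl , eq)
  ++-locate (x ∷ xs) []       refl = inj₁ (xs , refl , refl)
  ++-locate (x ∷ xs) (u ∷ us) eq with ∷-injective eq
  ... | refl , eq′ with ++-locate xs us eq′
  ...   | inj₁ (ws , refl , vs≡) = inj₁ (ws , refl , vs≡)
  ...   | inj₂ (ws , refl , ys≡) = inj₂ (ws , refl , ys≡)

  -- The induction is lexicographic on the cut formula, then the right premise,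
  -- then the left premise.  The context of the right premise is a variable Ξ
  -- so that this premise can be analysed by cases.
  cutNormal : ∀ A Γ → Normal (Θ ⟶ A) → Normal (Ξ ⟶ B) → Ξ ≡ Γ ++ A ∷ Δ →
              Normal (Γ ++ Θ ++ Δ ⟶ B)
  cutNormal (A * B) [] (left d) e eq = left (cutNormal (A * B) [] d e eq)
  cutNormal {Δ = Δ} (A * B) [] (right₀ {p} {Γ₁} {Γ₂} d₁ d₂) (left e) refl =
    recontext (sym (++-assoc (atom p ∷ Γ₁) Γ₂ Δ))
      (cutNormal A [] d₁ (cutNormal B [ A ] d₂ e refl) refl)
  cutNormal {Θ = Θ} (atom p) [] d (right₀ {Γ = Γ₁} {Δ = Γ₂} e₁ e₂) refl =
    recontext (++-assoc Θ Γ₁ Γ₂) (right (cutNormal (atom p) [] d e₁ refl) e₂)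
  cutNormal {Θ = Θ} (atom p) [] d ax refl = recontext (sym (++-identityʳ Θ)) d
  cutNormal A (_ ∷ Γ) d (left e) refl = left (cutNormal A (_ ∷ _ ∷ Γ) d e refl)
  cutNormal {Θ = Θ} {Δ = Δ} A (_ ∷ Γ) d (right₀ {p} {Γ₁} {Γ₂} e₁ e₂) eq
    with ∷-injective eq
  ... | refl , eq′ with ++-locate Γ₁ Γ eq′
  ...   | inj₁ (Ω , refl , refl) =
    recontext (trans (++-assoc (atom p ∷ Γ) (Θ ++ Ω) Γ₂)
                     (cong ((atom p ∷ Γ) ++_) (++-assoc Θ Ω Γ₂)))
      (right (cutNormal A (atom p ∷ Γ) d e₁ refl) e₂)
  ...   | inj₂ (Ω , refl , refl) =
    recontext (sym (++-assoc (atom p ∷ Γ₁) Ω (Θ ++ Δ)))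
      (right₀ e₁ (cutNormal A Ω d e₂ refl))
  cutNormal A (_ ∷ [])    d ax ()
  cutNormal A (_ ∷ _ ∷ _) d ax ()

  normalise : Derivation s → Normal s
  normalise (*L d)                = left (normalise d)
  normalise (*R d e)              = right (normalise d) (normalise e)
  normalise id                    = identity _
  normalise (cut {Γ = Γ} d e)     = cutNormal _ Γ (normalise d) (normalise e) refl

  -- Normal derivations are unique

  -- Number of atom occurrences.
  weight : Formula Atom → ℕ
  weight (atom _) = 1
  weight (A * B)  = weight A + weight B

  weights : Context Atom → ℕ
  weights []      = 0
  weights (A ∷ Γ) = weight A + weights Γ

  weight≢0 : ∀ A → ¬ weight A ≡ 0
  weight≢0 (A * B) eq = weight≢0 A (m+n≡0⇒m≡0 (weight A) eq)

  weights-++ : ∀ Γ Δ → weights (Γ ++ Δ) ≡ weights Γ + weights Δ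
  weights-++ []      Δ = refl
  weights-++ (A ∷ Γ) Δ = trans (cong (weight A +_) (weights-++ Γ Δ))
                               (sym (+-assoc (weight A) (weights Γ) (weights Δ)))

  weight-balance : Normal (Γ ⟶ A) → weights Γ ≡ weight A
  weight-balance (left {A} {B} {Δ = Δ} d) =
    trans (+-assoc (weight A) (weight B) (weights Δ)) (weight-balance d)
  weight-balance (right₀ {p} {Γ} {Δ} d e) =
    trans (weights-++ (atom p ∷ Γ) Δ) (cong₂ _+_ (weight-balance d) (weight-balance e))
  weight-balance ax = refl

  ++-split-unique : ∀ Γ Γ′ {Δ Δ′} → weights Γ ≡ weights Γ′ →
    Γ ++ Δ ≡ Γ′ ++ Δ′ → Γ ≡ Γ′ × Δ ≡ Δ′
  ++-split-unique []      []       w eq = refl , eq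
  ++-split-unique []      (A ∷ _)  w eq = ⊥-elim (weight≢0 A (m+n≡0⇒m≡0 (weight A) (sym w)))
  ++-split-unique (A ∷ _) []       w eq = ⊥-elim (weight≢0 A (m+n≡0⇒m≡0 (weight A) w))
  ++-split-unique (A ∷ Γ) (_ ∷ Γ′) w eq with ∷-injective eq
  ... | refl , eq′ with ++-split-unique Γ Γ′ (+-cancelˡ-≡ (weight A) _ _ w) eq′
  ...   | refl , Δ≡ = refl , Δ≡

  -- Stated across an equality of contexts, because the context of `right₀` is
  -- a concatenation and two such derivations cannot be matched directly.
  normal-unique-over : (d : Normal (Γ ⟶ A)) (e : Normal (Δ ⟶ A)) (eq : Γ ≡ Δ) →
                       recontext eq d ≡ e
  normal-unique-over (left d) (left e) refl = cong left (normal-unique-over d e refl)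
  normal-unique-over (right₀ {p} {Γ} d₁ d₂) (right₀ {q} {Γ′} e₁ e₂) eq
    with ++-split-unique (atom p ∷ Γ) (atom q ∷ Γ′)
           (trans (weight-balance d₁) (sym (weight-balance e₁))) eq
  normal-unique-over (right₀ d₁ d₂) (right₀ e₁ e₂) refl | refl , refl =
    cong₂ right₀ (normal-unique-over d₁ e₁ refl) (normal-unique-over d₂ e₂ refl)
  normal-unique-over ax ax refl = refl

  normal-unique : (d e : Normal s) → d ≡ e
  normal-unique d e = normal-unique-over d e refl

  -- Normal derivations are the focused derivations

  embed : Normal s → Derivation s
  embed (left d)     = *L (embed d)
  embed (right₀ d e) = *R (embed d) (embed e)
  embed ax           = id

  embed-focused : (d : Normal s) → Focused (embed d)
  embed-focused (left d) = record
    { leftInverting = λ _ → refl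
    ; rightFocusing = λ (irr , _) → ⊥-elim (irr (leftmost compound))
    ; atomic        = λ (irr , _) → ⊥-elim (irr (leftmost compound))
    } , embed-focused d
  embed-focused (right₀ d e) = record
    { leftInverting = λ { (leftmost ()) }
    ; rightFocusing = λ _ → refl
    ; atomic        = λ { (_ , ()) }
    } , embed-focused d , embed-focused e
  embed-focused ax = record
    { leftInverting = λ { (leftmost ()) }
    ; rightFocusing = λ { (_ , ()) }
    ; atomic        = λ _ → refl
    }

  -- A derivable sequent is left-inverting, right-focusing or atomic; which of
  -- the three is read off the last rule of a normal derivation of it.
  cut-concludes-nothing : Normal s → ¬ MayConclude cut s
  cut-concludes-nothing (left d) m with MayConclude.leftInverting m (leftmost compound)
  ... | ()
  cut-concludes-nothing (right₀ d e) m
    with MayConclude.rightFocusing m ((λ { (leftmost ()) }) , compound)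
  ... | ()
  cut-concludes-nothing ax m with MayConclude.atomic m ((λ { (leftmost ()) }) , isAtom)
  ... | ()

  -- In the case of the right rule, the left premise cannot end in the left
  -- rule: its context would make the context of the conclusion reducible.
  embed-surjective : (d : Derivation s) → Focused d → ∃[ n ] embed n ≡ d
  embed-surjective (*L d) (_ , fd) with embed-surjective d fd
  ... | n , refl = left n , refl
  embed-surjective (*R d e) (m , fd , fe) with embed-surjective d fd | embed-surjective e fe
  ... | right₀ n₁ n₂ , refl | n′ , refl = right₀ (right₀ n₁ n₂) n′ , refl
  ... | ax           , refl | n′ , refl = right₀ ax n′ , refl
  ... | left n       , refl | n′ , refl with MayConclude.leftInverting m (leftmost compound)
  ...   | ()
  embed-surjective (id {atom p}) _ = ax , refl
  embed-surjective (id {A * B}) m with MayConclude.leftInverting m (leftmost compound)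
  ... | ()
  embed-surjective d@(cut _ _) (m , _) = ⊥-elim (cut-concludes-nothing (normalise d) m)

mainTheorem4 : ∀ {a} {Atom : Set a} (Γ : Context Atom) (A : Formula Atom) →
    Derivation (Γ ⟶ A) →
    ∃! _≡_ (λ (d : Derivation (Γ ⟶ A)) → Focused d)
mainTheorem4 Γ A d = embed n , embed-focused n , unique
  where
  n = normalise d

  unique : ∀ {e} → Focused e → embed n ≡ e
  unique {e} fe with embed-surjective e fe
  ... | n′ , refl = cong embed (normal-unique n n′)
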